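{- Let $G$ be a finite simple connected graph. If the complement $\overline{G}$ is triangle-free and $\operatorname{diam}(\overline{G})=2$, then $pc_{1,2}(G)\leq 3$.
   Context: All graphs are finite, undirected and simple. An edge-coloring is an arbitrary map from the edge set to a set of colors (adjacent edges may receive the same color). In an edge-colored graph, a path $P$ is a distance $2$-proper path if no two edges of $P$ of the same color appear with fewer than $2$ edges in between on $P$; equivalently, any two distinct edges of $P$ that are consecutive on $P$ or separated by exactly one edge of $P$ have different colors. For a connected graph $G$, the $(1,2)$-proper connection number $pc_{1,2}(G)$ is the minimum number of colors in an edge-coloring of $G$ such that every two distinct vertices of $G$ are joined by a distance $2$-proper path in $G$. The condition $\operatorname{diam}(\overline{G})=2$ includes that $\overline{G}$ is connected. -}

module Defs where

open import Data.Fin using (Fin; toℕ) renaming (_<_ to _<ᶠ_)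
open import Data.Fin.Properties using (_≟_)
open import Data.List using (List; []; _∷_; length; lookup)
open import Data.List.Relation.Unary.Unique.Propositional using (Unique)
open import Data.Nat using (ℕ; zero; suc; _∸_; _≤_; _<_)
open import Data.Product using (Σ; ∃; ∃₂; _×_; _,_)
open import Level using (0ℓ)
open import Relation.Binary using (Rel; Symmetric; Irreflexive; Decidable)
open import Relation.Binary.Construct.Closure.ReflexiveTransitive using (Star; ε; _◅_)
open import Relation.Binary.PropositionalEquality using (_≡_; _≢_; ≢-sym)
open import Relation.Nullary using (¬_)
open import Relation.Nullary.Decidable using (¬?; _×-dec_)

record Graph (n : ℕ) : Set₁ where
  field
    Adj    : Rel (Fin n) 0ℓ
    sym    : Symmetric Adj
    irrefl : Irreflexive _≡_ Adj
    adj?   : Decidable Adj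

open Graph public using (Adj)

complement : ∀ {n} → Graph n → Graph n
complement G = record
  { Adj    = λ u v → u ≢ v × ¬ Adj G u v
  ; sym    = λ { (u≢v , ¬uv) → ≢-sym u≢v , λ vu → ¬uv (Graph.sym G vu) }
  ; irrefl = λ { u≡v (u≢v , _) → u≢v u≡v }
  ; adj?   = λ u v → ¬? (u ≟ v) ×-dec ¬? (Graph.adj? G u v)
  }

TriangleFree : ∀ {n} → Graph n → Set
TriangleFree G = ∀ u v w → ¬ (Adj G u v × Adj G v w × Adj G u w)

Walk : ∀ {n} → Graph n → Rel (Fin n) 0ℓ
Walk G = Star (Adj G)

module _ {n : ℕ} {G : Graph n} where

  vertices : ∀ {u v} → Walk G u v → List (Fin n)
  vertices {u} ε       = u ∷ []
  vertices {u} (_ ◅ p) = u ∷ vertices p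

  walkLength : ∀ {u v} → Walk G u v → ℕ
  walkLength ε       = zero
  walkLength (_ ◅ p) = suc (walkLength p)

record Path {n : ℕ} (G : Graph n) (u v : Fin n) : Set where
  constructor path
  field
    walk   : Walk G u v
    simple : Unique (vertices {G = G} walk)

open Path public

pathLength : ∀ {n} {G : Graph n} {u v} → Path G u v → ℕ
pathLength {G = G} p = walkLength {G = G} (walk p)

Connected : ∀ {n} → Graph n → Set
Connected G = ∀ u v → Path G u v

IsDistance : ∀ {n} → Graph n → Fin n → Fin n → ℕ → Set
IsDistance G u v d =
  (Σ (Path G u v) λ p → pathLength p ≡ d) ×
  (∀ (p : Path G u v) → d ≤ pathLength p)

-- The diameter is the maximum distance.  The first component makes every
-- distance finite, so a graph with a diameter in this sense is connected.
IsDiameter : ∀ {n} → Graph n → ℕ → Set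
IsDiameter G d =
  (∀ u v → ∃ λ e → IsDistance G u v e × e ≤ d) ×
  (∃₂ λ u v → IsDistance G u v d)

-- The adjacency argument is irrelevant and the colour is symmetric in the
-- endpoints, so this is a map on unordered edges; non-edges get no colour.
record EdgeColouring {n : ℕ} (G : Graph n) (k : ℕ) : Set where
  field
    colour     : ∀ u v → .(Adj G u v) → Fin k
    colour-sym : ∀ u v .(e : Adj G u v) →
                 colour u v e ≡ colour v u (Graph.sym G e)

open EdgeColouring public

walkColours : ∀ {n} {G : Graph n} {k} → EdgeColouring G k →
              ∀ {u v} → Walk G u v → List (Fin k)
walkColours c ε                       = []
walkColours {G = G} c {u} (_◅_ {j = w} e p) = colour c u w e ∷ walkColours {G = G} c p

-- For positions i < j on the path, exactly j ∸ suc i edges lie in between.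
DistanceProper : ∀ {k} → ℕ → List (Fin k) → Set
DistanceProper ℓ cs = ∀ (i j : Fin (length cs)) → i <ᶠ j →
  toℕ j ∸ suc (toℕ i) < ℓ → lookup cs i ≢ lookup cs j

IsDistanceProperPath : ∀ {n} {G : Graph n} {k} → ℕ → EdgeColouring G k →
                       ∀ {u v} → Path G u v → Set
IsDistanceProperPath {G = G} ℓ c p = DistanceProper ℓ (walkColours {G = G} c (walk p))

IsProperConnecting₁,₂ : ∀ {n} {G : Graph n} {k} → EdgeColouring G k → Set
IsProperConnecting₁,₂ {G = G} c =
  ∀ u v → u ≢ v → Σ (Path G u v) (IsDistanceProperPath 2 c)

IsMinimum : (ℕ → Set) → ℕ → Set
IsMinimum P k = P k × (∀ j → P j → k ≤ j)

-- k is the (1,2)-proper connection number of G.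
IsPc₁,₂ : ∀ {n} → Graph n → ℕ → Set
IsPc₁,₂ G = IsMinimum λ k → Σ (EdgeColouring G k) IsProperConnecting₁,₂

{-# OPTIONS --safe #-}
-- Write H for the complement of G and fix an H-edge xy, with H-neighbourhoods
-- X = N(x) and Y = N(y), which are cliques of G, and W the set of remaining
-- vertices.  W is nonempty, for otherwise H would be complete bipartite and G
-- disconnected.  Colour the W–X edges 0, the W–Y edges 1 and everything else 2.
-- Then x, y and any element of W provide paths for all H-edges except those
-- inside W, and an H-edge ww′ inside W is fine as soon as some w–p–q–w′ is a path
-- of G with p ∈ X, q ∈ Y.  If this fails for ww′ in both directions, choose common
-- H-neighbours p of x and w, p′ of x and w′, q of y and w, q′ of y and w′.  Then
-- p p′ q′ q is a 4-cycle of G such that every vertex off it is G-adjacent to two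
-- consecutive vertices on it, and an explicit colouring of the edges meeting the
-- cycle suffices.
module Submission where

open import Defs
open import Data.Bool using (Bool; true; false; _∨_; if_then_else_)
open import Data.Bool.Properties using (∨-comm; ∨-idem)
open import Data.Fin using (Fin; zero; suc; _↑ˡ_; _↑ʳ_; combine; remQuot)
open import Data.Fin.Patterns
open import Data.Fin.Properties using (_≟_; any?; all?; remQuot-combine)
open import Data.Fin.Subset using (Subset)
open import Data.Fin.Subset.Properties using (anySubset?)
open import Data.List using ([]; _∷_)
open import Data.List.Relation.Unary.All using ([]; _∷_)
open import Data.List.Relation.Unary.AllPairs using ([]; _∷_)
open import Data.Nat using (ℕ; _≤_; _*_; z≤n; s≤s; z<s; s<s)
open import Data.Nat.Properties using (≤-refl)
open import Data.Product using (Σ; ∃; ∃-syntax; ∃₂; _×_; _,_; proj₁; proj₂; uncurry)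
open import Data.Sum using (_⊎_; inj₁; inj₂)
open import Data.Vec using (Vec; []; _∷_; lookup; tabulate)
open import Data.Vec.Properties using (lookup∘tabulate)
open import Function using (_∘_)
open import Relation.Binary.Construct.Closure.ReflexiveTransitive using (ε; _◅_)
open import Relation.Binary.PropositionalEquality
  using (_≡_; _≢_; refl; sym; trans; cong; cong₂; subst₂; ≢-sym)
open import Relation.Nullary using (¬_; Dec; yes; no; contradiction)
open import Relation.Nullary.Decidable
  using (¬?; _×-dec_; _⊎-dec_; _→-dec_; decidable-stable; toWitness)

-- Colour sequences of short paths.

distanceProper₂ : ∀ {k} {a b : Fin k} → a ≢ b → DistanceProper 2 (a ∷ b ∷ [])
distanceProper₂ a≢b 0F 0F () _
distanceProper₂ a≢b 0F 1F _ _ = a≢b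
distanceProper₂ a≢b 1F 0F () _
distanceProper₂ a≢b 1F 1F (s<s ()) _

distanceProper₃ : ∀ {k} {a b c : Fin k} → a ≢ b → b ≢ c → a ≢ c →
                  DistanceProper 2 (a ∷ b ∷ c ∷ [])
distanceProper₃ a≢b b≢c a≢c 0F 0F () _
distanceProper₃ a≢b b≢c a≢c 0F 1F _ _ = a≢b
distanceProper₃ a≢b b≢c a≢c 0F 2F _ _ = a≢c
distanceProper₃ a≢b b≢c a≢c 1F 0F () _
distanceProper₃ a≢b b≢c a≢c 1F 1F (s<s ()) _
distanceProper₃ a≢b b≢c a≢c 1F 2F _ _ = b≢c
distanceProper₃ a≢b b≢c a≢c 2F 0F () _
distanceProper₃ a≢b b≢c a≢c 2F 1F (s<s ()) _
distanceProper₃ a≢b b≢c a≢c 2F 2F (s<s (s<s ())) _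

-- Over two colours three successive edges cannot be pairwise different, which limits distance
-- 2-proper paths to two edges.
Fin2-pigeonhole : (a b c : Fin 2) → a ≢ b → b ≢ c → a ≡ c
Fin2-pigeonhole = toWitness {a? = all? λ a → all? λ b → all? λ c →
  ¬? (a ≟ b) →-dec (¬? (b ≟ c) →-dec (a ≟ c))} _

-- Colourings from symmetric functions, and the decision between two and three colours.

module Colourings {n : ℕ} (G : Graph n) where

  H : Graph n
  H = complement G

  adj-stable : ∀ {u v} → u ≢ v → ¬ Adj H u v → Adj G u v
  adj-stable {u} {v} u≢v ¬uv =
    decidable-stable (Graph.adj? G u v) λ ¬e → ¬uv (u≢v , ¬e)

  adj⇒≢ : ∀ {u v} → Adj G u v → u ≢ v
  adj⇒≢ e u≡v = Graph.irrefl G u≡v e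

  module _ {k} (f : Fin n → Fin n → Fin k) (f-sym : ∀ u v → f u v ≡ f v u) where

    colouring : EdgeColouring G k
    colouring = record { colour = λ u v _ → f u v ; colour-sym = λ u v _ → f-sym u v }

    Bridge₂ : Fin n → Fin n → Set
    Bridge₂ u v = ∃ λ w → Adj G u w × Adj G w v × f u w ≢ f w v

    Bridge₃ : Fin n → Fin n → Set
    Bridge₃ u v = ∃₂ λ a b → (Adj G u a × Adj G a b × Adj G b v) ×
                             (f u a ≢ f a b × f a b ≢ f b v × f u a ≢ f b v)

    Bridge : Fin n → Fin n → Set
    Bridge u v = Bridge₂ u v ⊎ Bridge₃ u v

    bridge-sym : ∀ {u v} → Bridge u v → Bridge v u
    bridge-sym {u} {v} (inj₁ (w , e , e′ , uw≢wv)) =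
      inj₁ (w , Graph.sym G e′ , Graph.sym G e ,
            subst₂ _≢_ (f-sym w v) (f-sym u w) (≢-sym uw≢wv))
    bridge-sym {u} {v} (inj₂ (a , b , (e , e′ , e″) , (≢₁ , ≢₂ , ≢₃))) =
      inj₂ (b , a , (Graph.sym G e″ , Graph.sym G e′ , Graph.sym G e) ,
            ( subst₂ _≢_ (f-sym b v) (f-sym a b) (≢-sym ≢₂)
            , subst₂ _≢_ (f-sym a b) (f-sym u a) (≢-sym ≢₁)
            , subst₂ _≢_ (f-sym b v) (f-sym u a) (≢-sym ≢₃)))

    properConnecting : (∀ u v → Adj H u v → Bridge u v) →
                       IsProperConnecting₁,₂ colouring
    properConnecting bridge u v u≢v with Graph.adj? G u v
    ... | yes e = path (e ◅ ε) ((u≢v ∷ []) ∷ [] ∷ []) , λ { 0F 0F () _ }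
    ... | no ¬e with bridge u v (u≢v , ¬e)
    ... | inj₁ (w , e , e′ , c≢) =
      path (e ◅ e′ ◅ ε) ((adj⇒≢ e ∷ u≢v ∷ []) ∷ (adj⇒≢ e′ ∷ []) ∷ [] ∷ []) ,
      distanceProper₂ c≢
    ... | inj₂ (a , b , (e , e′ , e″) , (≢₁ , ≢₂ , ≢₃)) =
      path (e ◅ e′ ◅ e″ ◅ ε)
        ((adj⇒≢ e ∷ u≢b ∷ u≢v ∷ []) ∷ (adj⇒≢ e′ ∷ a≢v ∷ []) ∷ (adj⇒≢ e″ ∷ []) ∷ [] ∷ []) ,
      distanceProper₃ ≢₁ ≢₂ ≢₃
      where
      -- If `b` were `u`, the first two edges of the path would be the same edge, and symmetry of
      -- `f` would give them equal colours. The same happens at the other end if `a` is `v`.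
      u≢b : u ≢ b
      u≢b refl = ≢₁ (f-sym u a)
      a≢v : a ≢ v
      a≢v refl = ≢₂ (f-sym a b)

  Colourable : ℕ → Set
  Colourable k = Σ (EdgeColouring G k) IsProperConnecting₁,₂

  -- The path between vertices that are not adjacent in `G` has at least two edges, and its first
  -- two already differ in colour.
  colours-differ : ∀ {u v k} → Adj H u v → Colourable k → ∃₂ λ (a b : Fin k) → a ≢ b
  colours-differ {u} {v} (u≢v , ¬uv) (c , connect) with connect u v u≢v
  ... | path ε _ , _ = contradiction refl u≢v
  ... | path (e ◅ ε) _ , _ = contradiction e ¬uv
  ... | path (e ◅ e′ ◅ _) _ , proper = _ , _ , proper 0F 1F z<s z<s

  two≤colours : ∀ {u v k} → Adj H u v → Colourable k → 2 ≤ k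
  two≤colours {k = k} uv ck = at-least-two k (colours-differ uv ck)
    where
    at-least-two : ∀ k → (∃₂ λ (a b : Fin k) → a ≢ b) → 2 ≤ k
    at-least-two 1 (0F , 0F , a≢b) = contradiction refl a≢b
    at-least-two (ℕ.suc (ℕ.suc _)) _ = s≤s (s≤s z≤n)

  -- A third edge would require a third colour. Hence being connecting with two colours is a
  -- condition on single intermediate vertices, which can be checked by finite search.
  middle : ∀ (c : EdgeColouring G 2) → IsProperConnecting₁,₂ c → ∀ {u v} → Adj H u v →
           ∃ λ w → Σ (Adj G u w) λ e → Σ (Adj G w v) λ e′ → colour c u w e ≢ colour c w v e′
  middle c connect {u} {v} (u≢v , ¬uv) with connect u v u≢v
  ... | path ε _ , _ = contradiction refl u≢v
  ... | path (e ◅ ε) _ , _ = contradiction e ¬uv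
  ... | path (e ◅ e′ ◅ ε) _ , proper = _ , e , e′ , proper 0F 1F z<s z<s
  ... | path (e ◅ e′ ◅ e″ ◅ _) _ , proper = contradiction
    (Fin2-pigeonhole _ _ _ (proper 0F 1F z<s z<s) (proper 1F 2F (s<s z<s) z<s))
    (proper 0F 2F z<s (s<s z<s))

  bit : Bool → Fin 2
  bit b = if b then 1F else 0F

  bit⁻¹ : Fin 2 → Bool
  bit⁻¹ 0F = false
  bit⁻¹ 1F = true

  -- The argument is doubled because `decode` joins both orientations of a pair by `∨`. That makes
  -- every code decode to a symmetric function, and nothing is lost on a function that is already
  -- symmetric.
  bit-bit⁻¹ : ∀ i → bit (bit⁻¹ i ∨ bit⁻¹ i) ≡ i
  bit-bit⁻¹ 0F = refl
  bit-bit⁻¹ 1F = refl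

  -- Candidate 2-colourings are coded by sets of ordered pairs, so that the
  -- search for one is over a finite type.
  decode : Subset (n * n) → Fin n → Fin n → Fin 2
  decode S u v = bit (lookup S (combine u v) ∨ lookup S (combine v u))

  decode-sym : ∀ S u v → decode S u v ≡ decode S v u
  decode-sym S u v = cong bit (∨-comm (lookup S (combine u v)) _)

  encode : (Fin n → Fin n → Fin 2) → Subset (n * n)
  encode f = tabulate λ i → bit⁻¹ (uncurry f (remQuot n i))

  lookup-encode : ∀ f u v → lookup (encode f) (combine u v) ≡ bit⁻¹ (f u v)
  lookup-encode f u v = trans (lookup∘tabulate _ (combine u v))
    (cong (bit⁻¹ ∘ uncurry f) (remQuot-combine u v))

  decode-encode : ∀ f → (∀ u v → f u v ≡ f v u) → ∀ u v → decode (encode f) u v ≡ f u v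
  decode-encode f f-sym u v = trans
    (cong₂ (λ a b → bit (a ∨ b)) (lookup-encode f u v)
      (trans (lookup-encode f v u) (cong bit⁻¹ (f-sym v u))))
    (bit-bit⁻¹ (f u v))

  module _ (c : EdgeColouring G 2) where

    -- `encode` expects values on all pairs. The default `0F` at non-edges is harmless, since only
    -- the colours of edges of `G` are compared in the search.
    totalColour : Fin n → Fin n → Fin 2
    totalColour u v with Graph.adj? G u v
    ... | yes e = colour c u v e
    ... | no  _ = 0F

    totalColour-adj : ∀ {u v} (e : Adj G u v) → totalColour u v ≡ colour c u v e
    totalColour-adj {u} {v} e with Graph.adj? G u v
    ... | yes _ = refl
    ... | no ¬e = contradiction e ¬e

    totalColour-sym : ∀ u v → totalColour u v ≡ totalColour v u
    totalColour-sym u v with Graph.adj? G u v | Graph.adj? G v u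
    ... | yes e | yes _ = colour-sym c u v e
    ... | yes e | no ¬e = contradiction (Graph.sym G e) ¬e
    ... | no ¬e | yes e = contradiction (Graph.sym G e) ¬e
    ... | no _  | no _  = refl

  colourable₂? : Dec (Colourable 2)
  colourable₂? with anySubset? (λ S → all? λ u → all? λ v → Graph.adj? H u v →-dec
    any? λ w → Graph.adj? G u w ×-dec Graph.adj? G w v ×-dec
      ¬? (decode S u w ≟ decode S w v))
  ... | yes (S , bridge) = yes (colouring (decode S) (decode-sym S) ,
    properConnecting (decode S) (decode-sym S) λ u v uv → inj₁ (bridge u v uv))
  ... | no ¬S = no λ (c , connect) →
    let decode-adj : ∀ {u v} (e : Adj G u v) →
                     decode (encode (totalColour c)) u v ≡ colour c u v e
        decode-adj {u} {v} e = trans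
          (decode-encode (totalColour c) (totalColour-sym c) u v) (totalColour-adj c e)
    in ¬S (encode (totalColour c) , λ u v uv →
         let (w , e , e′ , c≢) = middle c connect uv
         in w , e , e′ , subst₂ _≢_ (sym (decode-adj e)) (sym (decode-adj e′)) c≢)

  -- The minimum has to be exhibited, not merely bounded. A nonadjacent pair excludes fewer than two
  -- colours, so deciding `Colourable 2` settles whether it is 2 or 3.
  pc≤3 : ∀ {u v} → Adj H u v → Colourable 3 → ∃[ k ] (IsPc₁,₂ G k × k ≤ 3)
  pc≤3 uv c₃ with colourable₂?
  ... | yes c₂ = 2 , (c₂ , λ _ → two≤colours uv) , s≤s (s≤s z≤n)
  ... | no ¬c₂ = 3 , (c₃ , λ j cj → three≤ (two≤colours uv cj) cj) , ≤-refl
    where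
    three≤ : ∀ {j} → 2 ≤ j → Colourable j → 3 ≤ j
    three≤ {1} (s≤s ()) _
    three≤ {2} _ c₂ = contradiction c₂ ¬c₂
    three≤ {ℕ.suc (ℕ.suc (ℕ.suc _))} _ _ = s≤s (s≤s (s≤s z≤n))

-- Three colours from a dominating 4-cycle.

next : Fin 4 → Fin 4
next 0F = 1F
next 1F = 2F
next 2F = 3F
next 3F = 0F

-- Class i < 4 consists of the i-th vertex of the 4-cycle alone, and class 4 + i of
-- vertices off the cycle which are adjacent to its i-th and (i+1)-st vertices.
corner side : Fin 4 → Fin 8
corner = _↑ˡ 4
side   = 4 ↑ʳ_

-- Two corners adjacent to every vertex of the class: the neighbours on the cycle for a corner, the
-- ends of its cycle edge for a side.
ends : Vec (Fin 4 × Fin 4) 8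
ends = (1F , 3F) ∷ (0F , 2F) ∷ (1F , 3F) ∷ (0F , 2F)
     ∷ (0F , 1F) ∷ (1F , 2F) ∷ (2F , 3F) ∷ (3F , 0F) ∷ []

-- Only the entries at consecutive corners and at a side with one of its ends matter.
cycleTable : Vec (Vec (Fin 3) 8) 8
cycleTable = (2F ∷ 2F ∷ 2F ∷ 0F ∷ 1F ∷ 2F ∷ 2F ∷ 1F ∷ [])
           ∷ (2F ∷ 2F ∷ 1F ∷ 2F ∷ 0F ∷ 0F ∷ 2F ∷ 2F ∷ [])
           ∷ (2F ∷ 1F ∷ 2F ∷ 0F ∷ 2F ∷ 2F ∷ 2F ∷ 2F ∷ [])
           ∷ (0F ∷ 2F ∷ 0F ∷ 2F ∷ 2F ∷ 2F ∷ 1F ∷ 2F ∷ [])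
           ∷ (1F ∷ 0F ∷ 2F ∷ 2F ∷ 2F ∷ 2F ∷ 2F ∷ 2F ∷ [])
           ∷ (2F ∷ 0F ∷ 2F ∷ 2F ∷ 2F ∷ 2F ∷ 2F ∷ 2F ∷ [])
           ∷ (2F ∷ 2F ∷ 2F ∷ 1F ∷ 2F ∷ 2F ∷ 2F ∷ 2F ∷ [])
           ∷ (1F ∷ 2F ∷ 2F ∷ 2F ∷ 2F ∷ 2F ∷ 2F ∷ 2F ∷ []) ∷ []

cycleColour : Fin 8 → Fin 8 → Fin 3
cycleColour s t = lookup (lookup cycleTable s) t

cycleColour-sym : ∀ s t → cycleColour s t ≡ cycleColour t s
cycleColour-sym = toWitness {a? = all? λ s → all? λ t → cycleColour s t ≟ cycleColour t s} _

Attached : Fin 8 → Fin 4 → Set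
Attached s a = a ≡ proj₁ (lookup ends s) ⊎ a ≡ proj₂ (lookup ends s)

attached? : ∀ s a → Dec (Attached s a)
attached? s a = (a ≟ proj₁ (lookup ends s)) ⊎-dec (a ≟ proj₂ (lookup ends s))

-- `Route₁` singles out class pairs whose vertices are never H-adjacent. The other two describe
-- paths through one or two hubs, so that their colours can be read off the table.
Route₁ Route₂ Route₃ Route : Fin 8 → Fin 8 → Set
Route₁ s t = ∃ λ a → s ≡ corner a × (t ≡ corner a ⊎ Attached t a)
Route₂ s t = ∃ λ a → Attached s a × Attached t a ×
                     cycleColour s (corner a) ≢ cycleColour (corner a) t
Route₃ s t = ∃ λ a → ∃ λ b → (Attached s a × Attached (corner a) b × Attached t b) ×
  ( cycleColour s (corner a) ≢ cycleColour (corner a) (corner b)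
  × cycleColour (corner a) (corner b) ≢ cycleColour (corner b) t
  × cycleColour s (corner a) ≢ cycleColour (corner b) t)
Route s t = Route₁ s t ⊎ Route₁ t s ⊎ Route₂ s t ⊎ Route₃ s t

route₁? : ∀ s t → Dec (Route₁ s t)
route₁? s t = any? λ a → s ≟ corner a ×-dec (t ≟ corner a ⊎-dec attached? t a)

route? : ∀ s t → Dec (Route s t)
route? s t = route₁? s t ⊎-dec route₁? t s
  ⊎-dec (any? λ a → attached? s a ×-dec attached? t a ×-dec
           ¬? (cycleColour s (corner a) ≟ cycleColour (corner a) t))
  ⊎-dec (any? λ a → any? λ b →
           (attached? s a ×-dec attached? (corner a) b ×-dec attached? t b) ×-dec
           (¬? (cycleColour s (corner a) ≟ cycleColour (corner a) (corner b))
           ×-dec ¬? (cycleColour (corner a) (corner b) ≟ cycleColour (corner b) t)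
           ×-dec ¬? (cycleColour s (corner a) ≟ cycleColour (corner b) t)))

abstract
  -- A finite check over all class pairs, including equal ones: each side class forms a rainbow
  -- triangle with its cycle edge, so two vertices of that class are joined across this edge.
  route : ∀ s t → Route s t
  route = toWitness {a? = all? λ s → all? λ t → route? s t} _

module DominatingCycle {n : ℕ} (G : Graph n) (hub : Fin 4 → Fin n)
  (cycle : ∀ i → Adj G (hub i) (hub (next i)))
  (chord₀₂ : hub 0F ≢ hub 2F) (chord₁₃ : hub 1F ≢ hub 3F)
  (attach : ∀ v → (∀ i → v ≢ hub i) → ∃ λ i → Adj G v (hub i) × Adj G v (hub (next i)))
  where

  open Colourings G

  hub-injective : ∀ i j → hub i ≡ hub j → i ≡ j
  hub-injective 0F 0F _ = refl
  hub-injective 0F 1F eq = contradiction eq (adj⇒≢ (cycle 0F))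
  hub-injective 0F 2F eq = contradiction eq chord₀₂
  hub-injective 0F 3F eq = contradiction (sym eq) (adj⇒≢ (cycle 3F))
  hub-injective 1F 0F eq = contradiction (sym eq) (adj⇒≢ (cycle 0F))
  hub-injective 1F 1F _ = refl
  hub-injective 1F 2F eq = contradiction eq (adj⇒≢ (cycle 1F))
  hub-injective 1F 3F eq = contradiction eq chord₁₃
  hub-injective 2F 0F eq = contradiction (sym eq) chord₀₂
  hub-injective 2F 1F eq = contradiction (sym eq) (adj⇒≢ (cycle 1F))
  hub-injective 2F 2F _ = refl
  hub-injective 2F 3F eq = contradiction eq (adj⇒≢ (cycle 2F))
  hub-injective 3F 0F eq = contradiction eq (adj⇒≢ (cycle 3F))
  hub-injective 3F 1F eq = contradiction (sym eq) chord₁₃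
  hub-injective 3F 2F eq = contradiction (sym eq) (adj⇒≢ (cycle 2F))
  hub-injective 3F 3F _ = refl

  data Class (v : Fin n) : Fin 8 → Set where
    at-corner : ∀ i → v ≡ hub i → Class v (corner i)
    at-side   : ∀ i → (∀ j → v ≢ hub j) → Adj G v (hub i) → Adj G v (hub (next i)) →
                Class v (side i)

  classify : ∀ v → ∃ (Class v)
  classify v with any? (λ i → v ≟ hub i)
  ... | yes (i , v≡) = corner i , at-corner i v≡
  ... | no v≢ with attach v (λ i v≡ → v≢ (i , v≡))
  ... | i , e , e′ = side i , at-side i (λ j v≡ → v≢ (j , v≡)) e e′

  class : Fin n → Fin 8
  class v = proj₁ (classify v)

  class-hub : ∀ i → class (hub i) ≡ corner i
  class-hub i with classify (hub i)
  ... | _ , at-corner j eq = cong corner (sym (hub-injective i j eq))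
  ... | _ , at-side _ off _ _ = contradiction refl (off i)

  corner-class : ∀ {v s} → Class v s → ∀ a → s ≡ corner a → v ≡ hub a
  corner-class (at-corner 0F v≡) 0F _ = v≡
  corner-class (at-corner 1F v≡) 1F _ = v≡
  corner-class (at-corner 2F v≡) 2F _ = v≡
  corner-class (at-corner 3F v≡) 3F _ = v≡

  attached⇒adj : ∀ {v s} → Class v s → ∀ {a} → Attached s a → Adj G v (hub a)
  attached⇒adj (at-corner 0F refl) (inj₁ refl) = cycle 0F
  attached⇒adj (at-corner 0F refl) (inj₂ refl) = Graph.sym G (cycle 3F)
  attached⇒adj (at-corner 1F refl) (inj₁ refl) = Graph.sym G (cycle 0F)
  attached⇒adj (at-corner 1F refl) (inj₂ refl) = cycle 1F
  attached⇒adj (at-corner 2F refl) (inj₁ refl) = Graph.sym G (cycle 1F)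
  attached⇒adj (at-corner 2F refl) (inj₂ refl) = cycle 2F
  attached⇒adj (at-corner 3F refl) (inj₁ refl) = cycle 3F
  attached⇒adj (at-corner 3F refl) (inj₂ refl) = Graph.sym G (cycle 2F)
  attached⇒adj (at-side 0F _ e e′) (inj₁ refl) = e
  attached⇒adj (at-side 0F _ e e′) (inj₂ refl) = e′
  attached⇒adj (at-side 1F _ e e′) (inj₁ refl) = e
  attached⇒adj (at-side 1F _ e e′) (inj₂ refl) = e′
  attached⇒adj (at-side 2F _ e e′) (inj₁ refl) = e
  attached⇒adj (at-side 2F _ e e′) (inj₂ refl) = e′
  attached⇒adj (at-side 3F _ e e′) (inj₁ refl) = e
  attached⇒adj (at-side 3F _ e e′) (inj₂ refl) = e′

  hub-attached⇒adj : ∀ {a b} → Attached (corner a) b → Adj G (hub a) (hub b)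
  hub-attached⇒adj {a} = attached⇒adj (at-corner a refl)

  f : Fin n → Fin n → Fin 3
  f u v = cycleColour (class u) (class v)

  f-sym : ∀ u v → f u v ≡ f v u
  f-sym u v = cycleColour-sym (class u) (class v)

  f-hubʳ : ∀ u a → f u (hub a) ≡ cycleColour (class u) (corner a)
  f-hubʳ u a = cong (cycleColour (class u)) (class-hub a)

  f-hubˡ : ∀ a v → f (hub a) v ≡ cycleColour (corner a) (class v)
  f-hubˡ a v = cong (λ s → cycleColour s (class v)) (class-hub a)

  f-hub : ∀ a b → f (hub a) (hub b) ≡ cycleColour (corner a) (corner b)
  f-hub a b = cong₂ cycleColour (class-hub a) (class-hub b)

  -- A corner class contains a single vertex, so `v` is either `u` itself or a `G`-neighbour of it.
  route₁⇒¬H : ∀ {u v} → Route₁ (class u) (class v) → ¬ Adj H u v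
  route₁⇒¬H {u} {v} (a , s≡ , t) (u≢v , ¬uv)
    with corner-class (proj₂ (classify u)) a s≡ | t
  ... | u≡ | inj₁ t≡ = u≢v (trans u≡ (sym (corner-class (proj₂ (classify v)) a t≡)))
  ... | refl | inj₂ at = ¬uv (Graph.sym G (attached⇒adj (proj₂ (classify v)) at))

  bridge : ∀ u v → Adj H u v → Bridge f f-sym u v
  bridge u v uv with route (class u) (class v)
  ... | inj₁ r = contradiction uv (route₁⇒¬H r)
  ... | inj₂ (inj₁ r) = contradiction (Graph.sym H uv) (route₁⇒¬H r)
  ... | inj₂ (inj₂ (inj₁ (a , ua , va , c≢))) = inj₁
    ( hub a , attached⇒adj (proj₂ (classify u)) ua
    , Graph.sym G (attached⇒adj (proj₂ (classify v)) va)
    , subst₂ _≢_ (sym (f-hubʳ u a)) (sym (f-hubˡ a v)) c≢)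
  ... | inj₂ (inj₂ (inj₂ (a , b , (ua , ab , vb) , (≢₁ , ≢₂ , ≢₃)))) = inj₂
    ( hub a , hub b
    , ( attached⇒adj (proj₂ (classify u)) ua , hub-attached⇒adj ab
      , Graph.sym G (attached⇒adj (proj₂ (classify v)) vb))
    , ( subst₂ _≢_ (sym (f-hubʳ u a)) (sym (f-hub a b)) ≢₁
      , subst₂ _≢_ (sym (f-hub a b)) (sym (f-hubˡ b v)) ≢₂
      , subst₂ _≢_ (sym (f-hubʳ u a)) (sym (f-hubˡ b v)) ≢₃))

  colourable₃ : Colourable 3
  colourable₃ = colouring f f-sym , properConnecting f f-sym bridge

-- Classes 0, 1 and 2 are X, Y and W; note that y ∈ X and x ∈ Y.
edgeTable : Vec (Vec (Fin 3) 3) 3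
edgeTable = (2F ∷ 2F ∷ 0F ∷ []) ∷ (2F ∷ 2F ∷ 1F ∷ []) ∷ (0F ∷ 1F ∷ 2F ∷ []) ∷ []

edgeColour : Fin 3 → Fin 3 → Fin 3
edgeColour s t = lookup (lookup edgeTable s) t

edgeColour-sym : ∀ s t → edgeColour s t ≡ edgeColour t s
edgeColour-sym = toWitness {a? = all? λ s → all? λ t → edgeColour s t ≟ edgeColour t s} _

-- The partition into X, Y and W around an edge of the complement.

module AroundEdge {n : ℕ} (G : Graph n) (connected : Connected G)
  (triangleFree : TriangleFree (complement G))
  (common : ∀ {u v} → u ≢ v → ¬ Adj (complement G) u v →
            ∃ λ m → Adj (complement G) u m × Adj (complement G) m v)
  {x y : Fin n} (xy : Adj (complement G) x y)
  where

  open Colourings G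

  private
    _~_ : Fin n → Fin n → Set
    _~_ = Adj H

    _~?_ : ∀ u v → Dec (u ~ v)
    _~?_ = Graph.adj? H

    ~-sym : ∀ {u v} → u ~ v → v ~ u
    ~-sym = Graph.sym H

    ~-stable : ∀ {u v} → ¬ ¬ (u ~ v) → u ~ v
    ~-stable {u} {v} = decidable-stable (u ~? v)

  ~⇒≢ : ∀ {m u v} → m ~ u → ¬ (m ~ v) → u ≢ v
  ~⇒≢ mu ¬mv refl = ¬mv mu

  independent : ∀ {m u v} → m ~ u → m ~ v → ¬ (u ~ v)
  independent mu mv uv = triangleFree _ _ _ (mu , uv , mv)

  clique : ∀ {m u v} → m ~ u → m ~ v → u ≢ v → Adj G u v
  clique mu mv u≢v = adj-stable u≢v (independent mu mv)

  X∩Y=∅ : ∀ {v} → x ~ v → ¬ (y ~ v)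
  X∩Y=∅ xv yv = independent xy xv yv

  W : Fin n → Set
  W v = ¬ (x ~ v) × ¬ (y ~ v)

  X-W-adj : ∀ {u v} → x ~ u → W v → ¬ (u ~ v) → Adj G u v
  X-W-adj xu (¬xv , _) = adj-stable (~⇒≢ xu ¬xv)

  Y-W-adj : ∀ {u v} → y ~ u → W v → ¬ (u ~ v) → Adj G u v
  Y-W-adj yu (_ , ¬yv) = adj-stable (~⇒≢ yu ¬yv)

  y-W-adj : ∀ {v} → W v → Adj G y v
  y-W-adj w = X-W-adj xy w (proj₂ w)

  x-W-adj : ∀ {v} → W v → Adj G x v
  x-W-adj w = Y-W-adj (~-sym xy) w (proj₁ w)

  W-nonempty : ∃ W
  W-nonempty with any? (λ v → ¬? (x ~? v) ×-dec ¬? (y ~? v))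
  ... | yes w = w
  -- No edge of `G` leaves X when W is empty, so a walk from `y`, which is in X, to `x` would put
  -- `x` into X as well.
  ... | no ¬w = contradiction (stays (walk (connected y x)) xy) (λ xx → proj₁ xx refl)
    where
    cover : ∀ v → ¬ (x ~ v) → y ~ v
    cover v ¬xv = ~-stable λ ¬yv → ¬w (v , ¬xv , ¬yv)
    -- Otherwise `u` and `v` have a common H-neighbour `m`. It is outside X because `u` is in X,
    -- hence it is in Y, where it cannot be H-adjacent to `v`.
    complete : ∀ {u v} → x ~ u → y ~ v → u ~ v
    complete {u} {v} xu yv = ~-stable λ ¬uv →
      let (m , um , mv) = common (~⇒≢ xu λ xv → X∩Y=∅ xv yv) ¬uv
      in independent yv (cover m λ xm → independent xu xm um) (~-sym mv)
    step : ∀ {u v} → x ~ u → Adj G u v → x ~ v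
    step {v = v} xu e = ~-stable λ ¬xv → proj₂ (complete xu (cover v ¬xv)) e
    stays : ∀ {u v} → Walk G u v → x ~ u → x ~ v
    stays ε xu = xu
    stays (e ◅ p) xu = stays p (step xu e)

  -- For `w` and `w′` in W this makes w-p-q-w′ a path of `G`, with colours 0, 2, 1. The notion is
  -- directed: X is met on the side of `w`.
  Good : Fin n → Fin n → Set
  Good w w′ = ∃ λ p → ∃ λ q → x ~ p × y ~ q × ¬ (w ~ p) × ¬ (w′ ~ q) × ¬ (p ~ q)

  good? : ∀ w w′ → Dec (Good w w′)
  good? w w′ = any? λ p → any? λ q → (x ~? p) ×-dec (y ~? q) ×-dec
    ¬? (w ~? p) ×-dec ¬? (w′ ~? q) ×-dec ¬? (p ~? q)

  -- First case: every H-edge inside W is good in some direction.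

  module AllGood
    (good : ∀ {w w′} → W w → W w′ → w ~ w′ → Good w w′ ⊎ Good w′ w) where

    data Class (v : Fin n) : Fin 3 → Set where
      inX : x ~ v → Class v 0F
      inY : y ~ v → Class v 1F
      inW : W v   → Class v 2F

    classify : ∀ v → ∃ (Class v)
    classify v with x ~? v | y ~? v
    ... | yes xv | _      = 0F , inX xv
    ... | no _   | yes yv = 1F , inY yv
    ... | no ¬xv | no ¬yv = 2F , inW (¬xv , ¬yv)

    class : Fin n → Fin 3
    class v = proj₁ (classify v)

    class-unique : ∀ {v s t} → Class v s → Class v t → s ≡ t
    class-unique (inX _) (inX _) = refl
    class-unique (inX xv) (inY yv) = contradiction yv (X∩Y=∅ xv)
    class-unique (inX xv) (inW (¬xv , _)) = contradiction xv ¬xv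
    class-unique (inY yv) (inX xv) = contradiction yv (X∩Y=∅ xv)
    class-unique (inY _) (inY _) = refl
    class-unique (inY yv) (inW (_ , ¬yv)) = contradiction yv ¬yv
    class-unique (inW (¬xv , _)) (inX xv) = contradiction xv ¬xv
    class-unique (inW (_ , ¬yv)) (inY yv) = contradiction yv ¬yv
    class-unique (inW _) (inW _) = refl

    f : Fin n → Fin n → Fin 3
    f u v = edgeColour (class u) (class v)

    f-sym : ∀ u v → f u v ≡ f v u
    f-sym u v = edgeColour-sym (class u) (class v)

    -- Disjointness of X, Y and W lets colours be computed from any proof of membership, whatever
    -- `classify` returns.
    f-class : ∀ {u v s t} → Class u s → Class v t → f u v ≡ edgeColour s t
    f-class {u} {v} us vt = cong₂ edgeColour
      (class-unique (proj₂ (classify u)) us) (class-unique (proj₂ (classify v)) vt)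

    bridge₂ : ∀ {u w v r s t} → Class u r → Class w s → Class v t →
              edgeColour r s ≢ edgeColour s t →
              Adj G u w → Adj G w v → Bridge f f-sym u v
    bridge₂ ur ws vt c≢ e e′ =
      inj₁ (_ , e , e′ , subst₂ _≢_ (sym (f-class ur ws)) (sym (f-class ws vt)) c≢)

    bridge₃ : ∀ {u a b v q r s t} → Class u q → Class a r → Class b s → Class v t →
              edgeColour q r ≢ edgeColour r s → edgeColour r s ≢ edgeColour s t →
              edgeColour q r ≢ edgeColour s t →
              Adj G u a → Adj G a b → Adj G b v → Bridge f f-sym u v
    bridge₃ uq ar bs vt ≢₁ ≢₂ ≢₃ e e′ e″ = inj₂ (_ , _ , (e , e′ , e″) ,
      ( subst₂ _≢_ (sym (f-class uq ar)) (sym (f-class ar bs)) ≢₁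
      , subst₂ _≢_ (sym (f-class ar bs)) (sym (f-class bs vt)) ≢₂
      , subst₂ _≢_ (sym (f-class uq ar)) (sym (f-class bs vt)) ≢₃))

    inX-y : Class y 0F
    inX-y = inX xy

    inY-x : Class x 1F
    inY-x = inY (~-sym xy)

    -- The path goes through `y`, with colours 2 and 0. Here `u` is not `y`, since `v` in W is not
    -- H-adjacent to `y`.
    X-W-bridge : ∀ {u v} → x ~ u → W v → u ~ v → Bridge f f-sym u v
    X-W-bridge xu w uv = bridge₂ (inX xu) inX-y (inW w) (λ ())
      (clique xu xy (~⇒≢ (~-sym uv) (λ vy → proj₂ w (~-sym vy)))) (y-W-adj w)

    Y-W-bridge : ∀ {u v} → y ~ u → W v → u ~ v → Bridge f f-sym u v
    Y-W-bridge yu w uv = bridge₂ (inY yu) inY-x (inW w) (λ ())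
      (clique yu (~-sym xy) (~⇒≢ (~-sym uv) (λ vx → proj₁ w (~-sym vx)))) (x-W-adj w)

    -- The candidates are u-y-w₀-v with colours 2, 0, 1 and u-w₀-x-v with colours 0, 1, 2. By
    -- triangle-freeness `w₀` is not H-adjacent to both `u` and `v`; the cases `u ≡ y` and `v ≡ x`
    -- shorten or exclude a candidate.
    X-Y-bridge : ∀ {u v} → x ~ u → y ~ v → u ~ v → Bridge f f-sym u v
    X-Y-bridge {u} {v} xu yv uv with W-nonempty
    ... | w₀ , w = go (u ≟ y) (v ≟ x) (w₀ ~? v)
      where
      via-y : u ≢ y → ¬ (w₀ ~ v) → Bridge f f-sym u v
      via-y u≢y ¬w₀v = bridge₃ (inX xu) inX-y (inW w) (inY yv) (λ ()) (λ ()) (λ ())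
        (clique xu xy u≢y) (y-W-adj w) (Graph.sym G (Y-W-adj yv w (¬w₀v ∘ ~-sym)))
      via-x : v ≢ x → ¬ (u ~ w₀) → Bridge f f-sym u v
      via-x v≢x ¬uw₀ = bridge₃ (inX xu) (inW w) inY-x (inY yv) (λ ()) (λ ()) (λ ())
        (X-W-adj xu w ¬uw₀) (Graph.sym G (x-W-adj w)) (clique (~-sym xy) yv (≢-sym v≢x))
      go : Dec (u ≡ y) → Dec (v ≡ x) → Dec (w₀ ~ v) → Bridge f f-sym u v
      go (yes refl) (yes refl) _ = bridge₂ inX-y (inW w) inY-x (λ ())
        (y-W-adj w) (Graph.sym G (x-W-adj w))
      go (yes refl) (no v≢x) _ = via-x v≢x (proj₂ w)
      go (no u≢y) _ (no ¬w₀v) = via-y u≢y ¬w₀v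
      go (no u≢y) _ (yes w₀v) = via-x (~⇒≢ w₀v (λ w₀x → proj₁ w (~-sym w₀x)))
        (λ uw₀ → independent uv uw₀ (~-sym w₀v))

    good-bridge : ∀ {u v} → W u → W v → Good u v → Bridge f f-sym u v
    good-bridge w w′ (p , q , xp , yq , ¬up , ¬vq , ¬pq) =
      bridge₃ (inW w) (inX xp) (inY yq) (inW w′) (λ ()) (λ ()) (λ ())
        (Graph.sym G (X-W-adj xp w (¬up ∘ ~-sym)))
        (adj-stable (~⇒≢ xp λ xq → X∩Y=∅ xq yq) ¬pq)
        (Y-W-adj yq w′ (¬vq ∘ ~-sym))

    class-bridge : ∀ {u v s t} → Class u s → Class v t → u ~ v → Bridge f f-sym u v
    class-bridge (inX xu) (inX xv) uv = contradiction uv (independent xu xv)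
    class-bridge (inX xu) (inY yv) uv = X-Y-bridge xu yv uv
    class-bridge (inX xu) (inW w) uv = X-W-bridge xu w uv
    class-bridge (inY yu) (inX xv) uv = bridge-sym f f-sym (X-Y-bridge xv yu (~-sym uv))
    class-bridge (inY yu) (inY yv) uv = contradiction uv (independent yu yv)
    class-bridge (inY yu) (inW w) uv = Y-W-bridge yu w uv
    class-bridge (inW w) (inX xv) uv = bridge-sym f f-sym (X-W-bridge xv w (~-sym uv))
    class-bridge (inW w) (inY yv) uv = bridge-sym f f-sym (Y-W-bridge yv w (~-sym uv))
    class-bridge (inW w) (inW w′) uv with good w w′ uv
    ... | inj₁ g = good-bridge w w′ g
    ... | inj₂ g = bridge-sym f f-sym (good-bridge w′ w g)

    colourable₃ : Colourable 3
    colourable₃ = colouring f f-sym , properConnecting f f-sym λ u v →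
      class-bridge (proj₂ (classify u)) (proj₂ (classify v))

  -- Second case: an H-edge inside W that is good in neither direction.

  module SomeBad {w w′ : Fin n} (wW : W w) (w′W : W w′) (ww′ : w ~ w′)
    (¬good : ¬ Good w w′) (¬good′ : ¬ Good w′ w) where

    private
      P = common (adj⇒≢ (x-W-adj wW)) (proj₁ wW)
      P′ = common (adj⇒≢ (x-W-adj w′W)) (proj₁ w′W)
      Q = common (adj⇒≢ (y-W-adj wW)) (proj₂ wW)
      Q′ = common (adj⇒≢ (y-W-adj w′W)) (proj₂ w′W)

      p p′ q q′ : Fin n
      p = proj₁ P
      p′ = proj₁ P′
      q = proj₁ Q
      q′ = proj₁ Q′

      xp : x ~ p
      xp = proj₁ (proj₂ P)
      xp′ : x ~ p′
      xp′ = proj₁ (proj₂ P′)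
      yq : y ~ q
      yq = proj₁ (proj₂ Q)
      yq′ : y ~ q′
      yq′ = proj₁ (proj₂ Q′)
      wp : w ~ p
      wp = ~-sym (proj₂ (proj₂ P))
      w′p′ : w′ ~ p′
      w′p′ = ~-sym (proj₂ (proj₂ P′))
      wq : w ~ q
      wq = ~-sym (proj₂ (proj₂ Q))
      w′q′ : w′ ~ q′
      w′q′ = ~-sym (proj₂ (proj₂ Q′))

    hub : Fin 4 → Fin n
    hub 0F = p
    hub 1F = p′
    hub 2F = q′
    hub 3F = q

    N-disjoint : ∀ {v} → w ~ v → ¬ (w′ ~ v)
    N-disjoint = independent ww′

    X≢Y : ∀ {u v} → x ~ u → y ~ v → u ≢ v
    X≢Y xu yv = ~⇒≢ xu λ xv → X∩Y=∅ xv yv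

    -- Consecutive hubs share an H-neighbour, in turn `x`, `w′`, `y` and `w`, hence lie in a common
    -- clique of `G`.
    cycle : ∀ i → Adj G (hub i) (hub (next i))
    cycle 0F = clique xp xp′ (~⇒≢ wp λ wp′ → N-disjoint wp′ w′p′)
    cycle 1F = clique w′p′ w′q′ (X≢Y xp′ yq′)
    cycle 2F = clique yq′ yq (≢-sym (~⇒≢ wq λ wq′ → N-disjoint wq′ w′q′))
    cycle 3F = clique wq wp (≢-sym (X≢Y xp yq))

    -- Otherwise w-a-b-w′ would witness `Good w w′`. Together with `bad′` this makes both diagonals
    -- of the 4-cycle, `p′ q` and `p q′`, edges of H.
    bad : ∀ {a b} → x ~ a → y ~ b → ¬ (w ~ a) → ¬ (w′ ~ b) → a ~ b
    bad xa yb ¬wa ¬w′b = ~-stable λ ¬ab → ¬good (_ , _ , xa , yb , ¬wa , ¬w′b , ¬ab)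

    bad′ : ∀ {a b} → x ~ a → y ~ b → ¬ (w′ ~ a) → ¬ (w ~ b) → a ~ b
    bad′ xa yb ¬w′a ¬wb = ~-stable λ ¬ab → ¬good′ (_ , _ , xa , yb , ¬w′a , ¬wb , ¬ab)

    ¬w~p′ : ¬ (w ~ p′)
    ¬w~p′ wp′ = N-disjoint wp′ w′p′
    ¬w~q′ : ¬ (w ~ q′)
    ¬w~q′ wq′ = N-disjoint wq′ w′q′
    ¬w′~p : ¬ (w′ ~ p)
    ¬w′~p = N-disjoint wp
    ¬w′~q : ¬ (w′ ~ q)
    ¬w′~q = N-disjoint wq

    -- In the two mixed cases `z` would close a triangle of H with a diagonal of the cycle.
    W-one-side : ∀ {z} → W z → z ~ p′ ⊎ z ~ q′ → ¬ (z ~ p ⊎ z ~ q)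
    -- A common neighbour of z and y lies in N(w) and in N(w′).
    W-one-side zW (inj₁ zp′) (inj₁ zp) =
      let (m , ym , mz) = common (adj⇒≢ (y-W-adj zW)) (proj₂ zW)
          w′m = ~-stable λ ¬w′m → independent zp′ (~-sym mz) (bad xp′ ym ¬w~p′ ¬w′m)
          wm = ~-stable λ ¬wm → independent zp (~-sym mz) (bad′ xp ym ¬w′~p ¬wm)
      in N-disjoint wm w′m
    W-one-side zW (inj₁ zp′) (inj₂ zq) = independent zp′ zq (bad xp′ yq ¬w~p′ ¬w′~q)
    W-one-side zW (inj₂ zq′) (inj₁ zp) = independent zp zq′ (bad′ xp yq′ ¬w′~p ¬w~q′)
    -- The mirror image, with `x` for `y`: if `w` missed `m`, then `bad` would join `m` to `q` and
    -- close a triangle with `z`; likewise for `w′`, `bad′` and `q′`.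
    W-one-side zW (inj₂ zq′) (inj₂ zq) =
      let (m , xm , mz) = common (adj⇒≢ (x-W-adj zW)) (proj₁ zW)
          wm = ~-stable λ ¬wm → independent (~-sym mz) zq (bad xm yq ¬wm ¬w′~q)
          w′m = ~-stable λ ¬w′m → independent (~-sym mz) zq′ (bad′ xm yq′ ¬w′m ¬w~q′)
      in N-disjoint wm w′m

    -- Vertices of X attach to `p p′` and those of Y to `q′ q`, inside the respective cliques. A
    -- vertex of W attaches to `p′ q′` unless it is H-adjacent to one of them, and then to `q p`.
    attach : ∀ v → (∀ i → v ≢ hub i) → ∃ λ i → Adj G v (hub i) × Adj G v (hub (next i))
    attach v off with x ~? v | y ~? v
    ... | yes xv | _ = 0F , clique xv xp (off 0F) , clique xv xp′ (off 1F)
    ... | no _ | yes yv = 2F , clique yv yq′ (off 2F) , clique yv yq (off 3F)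
    ... | no ¬xv | no ¬yv with (v ~? p′) ⊎-dec (v ~? q′)
    ... | no ¬v = 1F , adj-stable (off 1F) (¬v ∘ inj₁) , adj-stable (off 2F) (¬v ∘ inj₂)
    ... | yes v′ = 3F , adj-stable (off 3F) (W-one-side (¬xv , ¬yv) v′ ∘ inj₂)
                      , adj-stable (off 0F) (W-one-side (¬xv , ¬yv) v′ ∘ inj₁)

    open DominatingCycle G hub cycle (X≢Y xp yq′) (X≢Y xp′ yq) attach public
      using (colourable₃)

  colourable₃ : Colourable 3
  colourable₃ with any? (λ w → any? λ w′ →
    (¬? (x ~? w) ×-dec ¬? (y ~? w)) ×-dec (¬? (x ~? w′) ×-dec ¬? (y ~? w′)) ×-dec
    (w ~? w′) ×-dec ¬? (good? w w′) ×-dec ¬? (good? w′ w))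
  ... | yes (w , w′ , wW , w′W , ww′ , ¬g , ¬g′) = SomeBad.colourable₃ wW w′W ww′ ¬g ¬g′
  ... | no ¬bad = AllGood.colourable₃ λ {w} {w′} wW w′W ww′ →
    decidable-stable (good? w w′ ⊎-dec good? w′ w) λ ¬g →
      ¬bad (w , w′ , wW , w′W , ww′ , ¬g ∘ inj₁ , ¬g ∘ inj₂)

-- Consequences of diameter two, and the conclusion.

diameter₂⇒common : ∀ {n} (H : Graph n) → IsDiameter H 2 → ∀ {u v} → u ≢ v → ¬ Adj H u v →
                   ∃ λ m → Adj H u m × Adj H m v
diameter₂⇒common H (near , _) {u} {v} u≢v ¬uv with near u v
... | _ , ((path ε _ , refl) , _) , _ = contradiction refl u≢v
... | _ , ((path (e ◅ ε) _ , refl) , _) , _ = contradiction e ¬uv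
... | _ , ((path (e ◅ e′ ◅ ε) _ , refl) , _) , _ = _ , e , e′
... | _ , ((path (_ ◅ _ ◅ _ ◅ _) _ , refl) , _) , s≤s (s≤s ())

-- The pair realising the diameter is joined by a path of length two, whose first edge serves as
-- `xy`.
diameter₂⇒edge : ∀ {n} (H : Graph n) → IsDiameter H 2 → ∃₂ (Adj H)
diameter₂⇒edge H (_ , _ , _ , (path (e ◅ _) _ , _) , _) = _ , _ , e

theorem3p3 : (n : ℕ) (G : Graph n) → Connected G →
    TriangleFree (complement G) → IsDiameter (complement G) 2 →
    ∃[ k ] (IsPc₁,₂ G k × k ≤ 3)
theorem3p3 n G connected triangleFree diam =
  let (_ , _ , xy) = diameter₂⇒edge (complement G) diam
  in Colourings.pc≤3 G xy
       (AroundEdge.colourable₃ G connected triangleFree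
         (diameter₂⇒common (complement G) diam) xy)
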